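{- For all integers $m\ge1$, $r\ge0$ and $n\ge1$, $$\mathcal D_{m,r}(n,x)=(-1)^n\det M_n,$$ where $M_n$ is the $(n+1)\times(n+1)$ matrix with rows and columns indexed by $0,\dots,n$, whose row $0$ is $(1,x,x^2,\dots,x^n)$ and whose row $i$ for $1\le i\le n$ is $\big(w_{m,r}(0,i-1),w_{m,r}(1,i-1),\dots,w_{m,r}(n,i-1)\big)$; explicitly $$M_n=\begin{pmatrix}1&x&\cdots&x^{n-1}&x^n\\ 1&w_{m,r}(1,0)&\cdots&w_{m,r}(n-1,0)&w_{m,r}(n,0)\\ 0&1&\cdots&w_{m,r}(n-1,1)&w_{m,r}(n,1)\\ \vdots&&\ddots&&\vdots\\ 0&0&\cdots&1&w_{m,r}(n,n-1)\end{pmatrix}.$$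
   Context: For integers $m\ge1$, $n,k,r\ge0$: the $r$-Whitney numbers of the first kind $w_{m,r}(n,k)$ are defined by $\sum_{n\ge k}w_{m,r}(n,k)\frac{z^n}{n!}=(1+mz)^{ -r/m}\frac{\ln^k(1+mz)}{m^kk!}$ (so $w_{m,r}(n,n)=1$ and $w_{m,r}(n,k)=0$ for $k>n$); the $r$-Whitney numbers of the second kind $W_{m,r}(n,k)$ by $\sum_{n\ge k}W_{m,r}(n,k)\frac{z^n}{n!}=\frac{e^{rz}}{k!}\left(\frac{e^{mz}-1}{m}\right)^k$; and the $r$-Dowling polynomial is $\mathcal D_{m,r}(n,u):=\sum_{k=0}^nW_{m,r}(n,k)u^k$. -}

module Defs where

open import Algebra.Bundles using (CommutativeRing)
open import Data.Nat.Base as ℕ using (ℕ; zero; suc; NonZero; _∸_; _!)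
open import Data.Nat.Properties using (_!≢0; m*n≢0; m^n≢0)
open import Data.Integer.Base using (+_)
open import Data.Fin.Base using (Fin; zero; suc; toℕ; punchIn)
open import Data.Rational.Base using (ℚ; 0ℚ; 1ℚ; _/_; _+_; _*_; -_; _-_)
open import Data.Rational.Properties using (+-*-commutativeRing)
import Algebra.Properties.Semiring.Exp as Exp
import Algebra.Properties.Semiring.Sum as Sum

module ℚSum = Sum (CommutativeRing.semiring +-*-commutativeRing)
module ℚExp = Exp (CommutativeRing.semiring +-*-commutativeRing)
open ℚExp using (_^_)

fromℕ : ℕ → ℚ
fromℕ n = + n / 1

1/_! : ℕ → ℚ
1/ n ! = _/_ (+ 1) (n !) {{n !≢0}}

-- Formal power series over ℚ: f represents Σₙ f(n) zⁿ.

Series : Set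
Series = ℕ → ℚ

one : Series
one zero    = 1ℚ
one (suc _) = 0ℚ

infixl 6 _⊖_
_⊖_ : Series → Series → Series
(f ⊖ g) n = f n - g n

infixl 7 _⊗_
_⊗_ : Series → Series → Series
(f ⊗ g) n = ℚSum.sum {suc n} (λ i → f (toℕ i) * g (n ∸ toℕ i))

infixr 7 _•_
_•_ : ℚ → Series → Series
(c • f) n = c * f n

infixr 8 _^^_
_^^_ : Series → ℕ → Series
f ^^ zero  = one
f ^^ suc k = f ⊗ f ^^ k

-- dilate c f is f(cz).
dilate : ℚ → Series → Series
dilate c f n = (c ^ n) * f n

exp : Series
exp n = 1/ n !

-- log1+ is ln(1+z) = Σₙ≥₁ (-1)ⁿ⁻¹ zⁿ/n.
log1+ : Series
log1+ zero    = 0ℚ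
log1+ (suc n) = ((- 1ℚ) ^ n) * (+ 1 / suc n)

-- α(α-1)⋯(α-n+1)
falling : ℚ → ℕ → ℚ
falling α zero    = 1ℚ
falling α (suc n) = falling α n * (α - fromℕ n)

-- [1+z]^ α is (1+z)^α = Σₙ binom(α,n) zⁿ.
[1+z]^_ : ℚ → Series
([1+z]^ α) n = falling α n * 1/ n !

-- The sequence a with Σₙ a(n) zⁿ/n! = f.
egfCoeff : Series → ℕ → ℚ
egfCoeff f n = fromℕ (n !) * f n

module _ (m : ℕ) .{{_ : NonZero m}} (r : ℕ) where

  -- (1+mz)^(-r/m) lnᵏ(1+mz) / (mᵏ k!)
  whitney₁-gf : ℕ → Series
  whitney₁-gf k =
    _/_ (+ 1) (m ℕ.^ k ℕ.* k !) {{m*n≢0 (m ℕ.^ k) (k !) {{m^n≢0 m k}} {{k !≢0}}}}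
      • (dilate (fromℕ m) ([1+z]^ (- (+ r / m)))
          ⊗ dilate (fromℕ m) log1+ ^^ k)

  -- e^(rz)/k! · ((e^(mz) - 1)/m)ᵏ
  whitney₂-gf : ℕ → Series
  whitney₂-gf k =
    1/ k !
      • (dilate (fromℕ r) exp
          ⊗ ((+ 1 / m) • (dilate (fromℕ m) exp ⊖ one)) ^^ k)

  whitney₁ : ℕ → ℕ → ℚ
  whitney₁ n k = egfCoeff (whitney₁-gf k) n

  whitney₂ : ℕ → ℕ → ℚ
  whitney₂ n k = egfCoeff (whitney₂-gf k) n

module _ {c ℓ} (R : CommutativeRing c ℓ) where

  private
    module R = CommutativeRing R
    module RSum = Sum R.semiring
    module RExp = Exp R.semiring

  Matrix : ℕ → Set c
  Matrix n = Fin n → Fin n → R.Carrier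

  -- (-1)ⁿ
  sign : ℕ → R.Carrier
  sign n = (R.- R.1#) RExp.^ n

  -- Cofactor expansion along column 0.
  det : ∀ {n} → Matrix n → R.Carrier
  det {zero}  A = R.1#
  det {suc n} A = RSum.sum λ i →
    sign (toℕ i) R.* A i zero R.* det (λ p q → A (punchIn i p) (suc q))

  -- The rational coefficients act on R through φ; the polynomial itself is
  -- the case where R is ℚ[x] and u is the indeterminate.
  module _ (φ : ℚ → R.Carrier) (m : ℕ) .{{_ : NonZero m}} (r : ℕ) where

    dowling : ℕ → R.Carrier → R.Carrier
    dowling n u = RSum.sum {suc n} λ k →
      φ (whitney₂ m r n (toℕ k)) R.* u RExp.^ toℕ k

    dowlingMatrix : ∀ n → R.Carrier → Matrix (suc n)
    dowlingMatrix n x zero    j = x RExp.^ toℕ j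
    dowlingMatrix n x (suc i) j = φ (whitney₁ m r (toℕ j) (toℕ i))

{-# OPTIONS --safe #-}

-- Differentiating the generating functions along the derivation θ f = (1 + sz) f′,
-- with s = m for the first kind and s = 0 for the second,
-- yields w(n+1,k) + (r+mn) w(n,k) = w(n,k−1) and W(n+1,k) = (r+mk) W(n,k) + W(n,k−1).
-- Hence P(n,k) = Σⱼ w(j,k) W(n,j) satisfies P(n+1,k) = P(n,k−1), i.e. P is the identity.
-- For an arbitrary row 0, v, the determinant is (−1)ⁿ Σⱼ vⱼ W(n,j): in the expansion
-- along column 0 only the first two minors survive, both have the shape of the
-- original matrix for the tables shifted by (1,1), and Σⱼ w(j,0) W(n,j) = 0 combines them.
module Submission where

open import Defs
open import Algebra.Bundles using (CommutativeRing)
open import Algebra.Morphism.Structures using (module RingMorphisms)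
open import Data.Nat.Base using (ℕ; NonZero)
open import Data.Rational.Base using (ℚ; +-*-rawRing)

import Algebra.Properties.Semiring.Exp as Exp
import Algebra.Properties.Semiring.Sum as Sum
open import Data.Fin.Base using (zero; suc; toℕ; punchIn)
open import Data.Fin.Properties using (toℕ-inject₁; toℕ-fromℕ)
open import Data.Integer.Base as ℤ using (+_)
import Data.Integer.Properties as ℤ
open import Data.Nat.Base as ℕ using (zero; suc; _<_; s<s; z<s; s<s⁻¹; _!)
import Data.Nat.Properties as ℕ
open import Data.Nat.Solver using (module +-*-Solver)
open import Data.Rational.Base using (0ℚ; 1ℚ)
import Data.Rational.Unnormalised.Base as ℚᵘ
import Data.Rational.Unnormalised.Properties as ℚᵘ
open import Function.Base using (_∘_)
import Relation.Binary.PropositionalEquality as ≡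

module _ {a} {A : Set a} where

  infixr 5 _◂_
  -- Gives the index k-1 a meaning at k = 0: `(0# ◂ f) k` is f(k-1) with f(-1) = 0, and
  -- `1# ◂ λ _ → 0#` is the Kronecker delta at 0.
  _◂_ : A → (ℕ → A) → ℕ → A
  (z ◂ f) zero    = z
  (z ◂ f) (suc k) = f k

-- Orthogonal triangular tables and a bordered determinant

module Inversion {c ℓ} (R : CommutativeRing c ℓ) where
  open CommutativeRing R hiding (zero)
  open Sum semiring
  open import Relation.Binary.Reasoning.Setoid setoid
  open import Algebra.Solver.Ring.NaturalCoefficients.Default commutativeSemiring
    using (solve; _:+_; _:*_; _:=_)

  sum-drop : ∀ k {n} (f : ℕ → Carrier) → (∀ {j} → j < k → f j ≈ 0#) →
             ∑[ i < k ℕ.+ n ] f (toℕ i) ≈ ∑[ i < n ] f (k ℕ.+ toℕ i)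
  sum-drop zero    f f≈0 = refl
  sum-drop (suc k) {n} f f≈0 = begin
    f 0 + ∑[ i < k ℕ.+ n ] f (suc (toℕ i))  ≈⟨ +-cong (f≈0 z<s) (sum-drop k (λ j → f (suc j)) (λ j<k → f≈0 (s<s j<k))) ⟩
    0# + ∑[ i < n ] f (suc k ℕ.+ toℕ i)     ≈⟨ +-identityˡ _ ⟩
    ∑[ i < n ] f (suc k ℕ.+ toℕ i)          ∎

  sum-last : ∀ n (f : ℕ → Carrier) → ∑[ i < suc n ] f (toℕ i) ≈ ∑[ i < n ] f (toℕ i) + f n
  sum-last n f = trans (sum-init-last (λ i → f (toℕ i)))
    (+-cong (sum-cong-≋ {n} (λ i → reflexive (≡.cong f (toℕ-inject₁ i))))
            (reflexive (≡.cong f (toℕ-fromℕ n))))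

  sum-zero : ∀ n (f : ℕ → Carrier) → (∀ j → f j ≈ 0#) → ∑[ i < n ] f (toℕ i) ≈ 0#
  sum-zero n f f≈0 = trans (sum-cong-≋ {n} (λ i → f≈0 (toℕ i))) (sum-replicate-zero n)

  module Orthogonality
           (c : ℕ → Carrier) (w W : ℕ → ℕ → Carrier)
           (w₀ : ∀ k → w 0 k ≈ (1# ◂ λ _ → 0#) k)
           (W₀ : ∀ k → W 0 k ≈ (1# ◂ λ _ → 0#) k)
           (w-rec : ∀ n k → w (suc n) k + c n * w n k ≈ (0# ◂ w n) k)
           (W-rec : ∀ n k → W (suc n) k ≈ c k * W n k + (0# ◂ W n) k)
    where

    w-upper : ∀ {n k} → n < k → w n k ≈ 0#
    w-upper {zero}  {suc k} _   = w₀ (suc k)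
    w-upper {suc n} {suc k} n<k = begin
      w (suc n) (suc k)                      ≈⟨ +-identityʳ _ ⟨
      w (suc n) (suc k) + 0#                 ≈⟨ +-congˡ (zeroʳ (c n)) ⟨
      w (suc n) (suc k) + c n * 0#           ≈⟨ +-congˡ (*-congˡ (w-upper (ℕ.m<n⇒m<1+n (s<s⁻¹ n<k)))) ⟨
      w (suc n) (suc k) + c n * w n (suc k)  ≈⟨ w-rec n (suc k) ⟩
      w n k                                  ≈⟨ w-upper (s<s⁻¹ n<k) ⟩
      0#                                     ∎

    w-diag : ∀ n → w n n ≈ 1#
    w-diag zero    = w₀ 0
    w-diag (suc n) = begin
      w (suc n) (suc n)                      ≈⟨ +-identityʳ _ ⟨
      w (suc n) (suc n) + 0#                 ≈⟨ +-congˡ (zeroʳ (c n)) ⟨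
      w (suc n) (suc n) + c n * 0#           ≈⟨ +-congˡ (*-congˡ (w-upper (ℕ.n<1+n n))) ⟨
      w (suc n) (suc n) + c n * w n (suc n)  ≈⟨ w-rec n (suc n) ⟩
      w n n                                  ≈⟨ w-diag n ⟩
      1#                                     ∎

    W-upper : ∀ {n k} → n < k → W n k ≈ 0#
    W-upper {zero}  {suc k} _   = W₀ (suc k)
    W-upper {suc n} {suc k} n<k = begin
      W (suc n) (suc k)                  ≈⟨ W-rec n (suc k) ⟩
      c (suc k) * W n (suc k) + W n k    ≈⟨ +-cong (*-congˡ (W-upper (ℕ.m<n⇒m<1+n (s<s⁻¹ n<k)))) (W-upper (s<s⁻¹ n<k)) ⟩
      c (suc k) * 0# + 0#                ≈⟨ +-identityʳ _ ⟩
      c (suc k) * 0#                     ≈⟨ zeroʳ _ ⟩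
      0#                                 ∎

    W-diag : ∀ n → W n n ≈ 1#
    W-diag zero    = W₀ 0
    W-diag (suc n) = begin
      W (suc n) (suc n)                  ≈⟨ W-rec n (suc n) ⟩
      c (suc n) * W n (suc n) + W n n    ≈⟨ +-cong (*-congˡ (W-upper (ℕ.n<1+n n))) (W-diag n) ⟩
      c (suc n) * 0# + 1#                ≈⟨ +-congʳ (zeroʳ _) ⟩
      0# + 1#                            ≈⟨ +-identityˡ _ ⟩
      1#                                 ∎

    -- By `w-rec`, row n of `w` lists the coefficients of the product of (x - c i) over i < n; by
    -- `W-rec`, row n of `W` expands xⁿ in these products. So this is the coefficient of xᵏ in xⁿ.
    product : ℕ → ℕ → Carrier
    product n k = ∑[ i ≤ n ] (w (toℕ i) k * W n (toℕ i))

    -- Summation by parts: `W-rec` splits each term into a diagonal and a shifted one, and after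
    -- reindexing the shifted ones `w-rec` absorbs the factor `c j`.
    product-suc : ∀ n k → product (suc n) k ≈ (0# ◂ product n) k
    product-suc n k = begin
      ∑[ i ≤ suc n ] (w (toℕ i) k * W (suc n) (toℕ i))
        ≈⟨ sum-cong-≋ {suc (suc n)} (λ i → let j = toℕ i in
             trans (*-congˡ (W-rec n j)) (expand (w j k) (c j) (W n j) ((0# ◂ W n) j))) ⟩
      ∑[ i ≤ suc n ] (diagonal (toℕ i) + shifted (toℕ i))
        ≈⟨ ∑-distrib-+ {suc (suc n)} (λ i → diagonal (toℕ i)) (λ i → shifted (toℕ i)) ⟩
      ∑[ i ≤ suc n ] diagonal (toℕ i) + ∑[ i ≤ suc n ] shifted (toℕ i)
        -- `shifted 0` contains the default value `0#`, so the second sum loses its first term and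
        -- its index moves by one; `diagonal (suc n)` contains `W n (suc n)`, which vanishes.
        ≈⟨ +-cong diagonal-sum (trans (+-congʳ (zeroʳ _)) (+-identityˡ _)) ⟩
      ∑[ i ≤ n ] diagonal (toℕ i) + ∑[ i ≤ n ] (w (suc (toℕ i)) k * W n (toℕ i))
        ≈⟨ ∑-distrib-+ {suc n} (λ i → diagonal (toℕ i)) (λ i → w (suc (toℕ i)) k * W n (toℕ i)) ⟨
      ∑[ i ≤ n ] (diagonal (toℕ i) + w (suc (toℕ i)) k * W n (toℕ i))
        ≈⟨ sum-cong-≋ {suc n} (λ i → let j = toℕ i in
             trans (collect (c j) (w j k) (W n j) (w (suc j) k)) (*-congʳ (w-rec j k))) ⟩
      ∑[ i ≤ n ] ((0# ◂ w (toℕ i)) k * W n (toℕ i))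
        ≈⟨ sum-◂ k ⟩
      (0# ◂ product n) k ∎
      where
      diagonal shifted : ℕ → Carrier
      diagonal j = c j * w j k * W n j
      shifted  j = w j k * (0# ◂ W n) j

      expand : ∀ x c y z → x * (c * y + z) ≈ c * x * y + x * z
      expand = solve 4 (λ x c y z → x :* (c :* y :+ z) := c :* x :* y :+ x :* z) refl

      collect : ∀ c x y z → c * x * y + z * y ≈ (z + c * x) * y
      collect = solve 4 (λ c x y z → c :* x :* y :+ z :* y := (z :+ c :* x) :* y) refl

      diagonal-sum : ∑[ i ≤ suc n ] diagonal (toℕ i) ≈ ∑[ i ≤ n ] diagonal (toℕ i)
      diagonal-sum = begin
        ∑[ i ≤ suc n ] diagonal (toℕ i)                ≈⟨ sum-last (suc n) diagonal ⟩
        ∑[ i ≤ n ] diagonal (toℕ i) + diagonal (suc n)  ≈⟨ +-congˡ (*-congˡ (W-upper (ℕ.n<1+n n))) ⟩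
        ∑[ i ≤ n ] diagonal (toℕ i) + c (suc n) * w (suc n) k * 0#  ≈⟨ +-congˡ (zeroʳ _) ⟩
        ∑[ i ≤ n ] diagonal (toℕ i) + 0#               ≈⟨ +-identityʳ _ ⟩
        ∑[ i ≤ n ] diagonal (toℕ i)                    ∎

      sum-◂ : ∀ k → ∑[ i ≤ n ] ((0# ◂ w (toℕ i)) k * W n (toℕ i)) ≈ (0# ◂ product n) k
      sum-◂ zero    = sum-zero (suc n) (λ j → 0# * W n j) (λ j → zeroˡ _)
      sum-◂ (suc k) = refl

    -- Each use of `product-suc` lowers row and column by one; after k of them the column is 0 and
    -- the row still positive, where `product-suc` gives `0#`.
    product-off-diag : ∀ k n → product (k ℕ.+ suc n) k ≈ 0#
    product-off-diag zero    n = product-suc n 0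
    product-off-diag (suc k) n = trans (product-suc (k ℕ.+ suc n) (suc k)) (product-off-diag k n)

    -- The terms with j < k vanish, so the sum may start at k. In this form the statement at `suc k`
    -- is the statement at k for the tables shifted by (1,1).
    orthogonal : ∀ k n →
      ∑[ i ≤ suc n ] (w (k ℕ.+ toℕ i) k * W (k ℕ.+ suc n) (k ℕ.+ toℕ i)) ≈ 0#
    orthogonal k n = begin
      ∑[ i ≤ suc n ] term (k ℕ.+ toℕ i)
        ≈⟨ sum-drop k {suc (suc n)} term (λ j<k → trans (*-congʳ (w-upper j<k)) (zeroˡ _)) ⟨
      ∑[ i < k ℕ.+ suc (suc n) ] term (toℕ i)
        ≡⟨ ≡.cong (λ N → ∑[ i < N ] term (toℕ i)) (ℕ.+-suc k (suc n)) ⟩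
      product (k ℕ.+ suc n) k
        ≈⟨ product-off-diag k n ⟩
      0# ∎
      where
      term : ℕ → Carrier
      term j = w j k * W (k ℕ.+ suc n) j

  -- Only unitriangularity and orthogonality are assumed because these pass to the shifted tables,
  -- whereas `w-rec` does not: in column 0 the shifted table would meet `w (suc n) 0` instead of
  -- `0#`. The row `v` is arbitrary since one minor has column 0 of `w` in that place, and `M` is
  -- described entrywise so that minors qualify.
  det-bordered : (w W : ℕ → ℕ → Carrier) →
    (∀ {n k} → n < k → w n k ≈ 0#) → (∀ n → w n n ≈ 1#) → (∀ n → W n n ≈ 1#) →
    (∀ k n → ∑[ i ≤ suc n ] (w (k ℕ.+ toℕ i) k * W (k ℕ.+ suc n) (k ℕ.+ toℕ i)) ≈ 0#) →
    ∀ n (v : ℕ → Carrier) (M : Matrix R (suc n)) →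
    (∀ j → M zero j ≈ v (toℕ j)) → (∀ i j → M (suc i) j ≈ w (toℕ j) (toℕ i)) →
    det R M ≈ sign R n * ∑[ i ≤ n ] (v (toℕ i) * W n (toℕ i))
  det-bordered w W w-upper w-diag W-diag w⊥W zero v M top bottom = begin
    1# * M zero zero * 1# + 0#  ≈⟨ +-congʳ (*-congʳ (*-congˡ (top zero))) ⟩
    1# * v 0 * 1# + 0#          ≈⟨ +-congʳ (*-congʳ (*-identityˡ _)) ⟩
    v 0 * 1# + 0#               ≈⟨ +-congʳ (*-congˡ (W-diag 0)) ⟨
    v 0 * W 0 0 + 0#            ≈⟨ *-identityˡ _ ⟨
    1# * (v 0 * W 0 0 + 0#)     ∎
  det-bordered w W w-upper w-diag W-diag w⊥W (suc n) v M top bottom = begin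
    1# * M zero zero * det R minor₀ + ((- 1# * 1#) * M (suc zero) zero * det R minor₁ + rest)
      ≈⟨ +-cong (*-cong (*-congˡ (top zero)) minor₀-det)
                (+-cong (*-cong (*-congˡ (trans (bottom zero zero) (w-diag 0))) minor₁-det) rest≈0) ⟩
    1# * v 0 * (σ * S₀) + ((- 1# * 1#) * 1# * (σ * S₁) + 0#)
      ≈⟨ +-cong (trans (*-congʳ (*-identityˡ _)) (swap _ _ _))
                (trans (+-identityʳ _) (trans (*-congʳ (trans (*-identityʳ _) (*-identityʳ _))) (sym (*-assoc _ _ _)))) ⟩
    σ * v 0 * S₀ + - 1# * σ * S₁
      -- The `- 1#` in the value of `S₀` matches the cofactor sign of row 1, so `v 0 * W (suc n) 0`
      -- becomes the term j = 0 missing from `S₁`.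
      ≈⟨ +-congʳ (*-congˡ S₀-value) ⟩
    σ * v 0 * (- 1# * W (suc n) 0) + - 1# * σ * S₁
      ≈⟨ regroup _ _ _ _ _ ⟩
    - 1# * σ * (v 0 * W (suc n) 0 + S₁) ∎
    where
    open import Algebra.Properties.Ring (CommutativeRing.ring R) using (-1*x≈-x; +-inverseʳ-unique)
    minor₀ minor₁ : Matrix R (suc n)
    minor₀ p q = M (punchIn zero p) (suc q)
    minor₁ p q = M (punchIn (suc zero) p) (suc q)

    w′ W′ : ℕ → ℕ → Carrier
    w′ i j = w (suc i) (suc j)
    W′ i j = W (suc i) (suc j)

    σ S₀ S₁ rest : Carrier
    σ  = sign R n
    S₀ = ∑[ i ≤ n ] (w (suc (toℕ i)) 0 * W (suc n) (suc (toℕ i)))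
    S₁ = ∑[ i ≤ n ] (v (suc (toℕ i)) * W (suc n) (suc (toℕ i)))
    rest = ∑[ i < n ] (sign R (suc (suc (toℕ i))) * M (suc (suc i)) zero
                         * det R (λ p q → M (punchIn (suc (suc i)) p) (suc q)))

    -- Deleting row 0 leaves column 0 of `w` on top, deleting row 1 leaves `v`; both are shifted by
    -- one, above the same rows of `w′`.
    minor-det = det-bordered w′ W′ (λ n<k → w-upper (s<s n<k)) (λ n → w-diag (suc n))
      (λ n → W-diag (suc n)) (λ k n → w⊥W (suc k) n) n

    minor₀-det : det R minor₀ ≈ σ * S₀
    minor₀-det = minor-det (λ j → w (suc j) 0) minor₀
      (λ j → bottom zero (suc j)) (λ i j → bottom (suc i) (suc j))

    minor₁-det : det R minor₁ ≈ σ * S₁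
    minor₁-det = minor-det (λ j → v (suc j)) minor₁
      (λ j → top (suc j)) (λ i j → bottom (suc i) (suc j))

    rest≈0 : rest ≈ 0#
    rest≈0 = trans
      (sum-cong-≋ {n} (λ i → trans
        (*-congʳ (trans (*-congˡ (trans (bottom (suc i) zero) (w-upper z<s))) (zeroʳ _)))
        (zeroˡ _)))
      (sum-replicate-zero n)

    S₀-value : S₀ ≈ - 1# * W (suc n) 0
    S₀-value = trans
      -- As `w 0 0` is `1#`, orthogonality at k = 0 reads `W (suc n) 0 + S₀ ≈ 0#`.
      (+-inverseʳ-unique _ _ (trans (+-congʳ (trans (sym (*-identityˡ _)) (*-congʳ (sym (w-diag 0))))) (w⊥W 0 n)))
      (sym (-1*x≈-x _))

    swap : ∀ x y z → x * (y * z) ≈ y * x * z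
    swap = solve 3 (λ x y z → x :* (y :* z) := y :* x :* z) refl

    regroup : ∀ e s v x y → s * v * (e * x) + e * s * y ≈ e * s * (v * x + y)
    regroup = solve 5 (λ e s v x y → s :* v :* (e :* x) :+ e :* s :* y := e :* s :* (v :* x :+ y)) refl

-- Formal power series over ℚ

module FormalSeries where
  open import Data.Rational.Base hiding (NonZero; 1/_)
  open import Data.Rational.Properties
  open import Relation.Binary.PropositionalEquality
  open import Algebra.Solver.Ring.NaturalCoefficients.Default
    (CommutativeRing.commutativeSemiring +-*-commutativeRing)
    using (solve; _:+_; _:*_; _:=_; con)
  open ℚExp using (_^_)

  module Fractions where
    open ℚᵘ.≤-Reasoning

    -- Normalisation by a gcd blocks computation with variables; among unnormalised fractions each
    -- identity below is an integer cross-multiplication.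
    toℚᵘ-/ : ∀ i n .{{_ : NonZero n}} → toℚᵘ (i / n) ℚᵘ.≃ (i ℚᵘ./ n)
    toℚᵘ-/ i (suc n) = toℚᵘ-fromℚᵘ (ℚᵘ.mkℚᵘ i n)

    fromℕ-suc : ∀ n → fromℕ (suc n) ≡ 1ℚ + fromℕ n
    fromℕ-suc n = toℚᵘ-injective (begin-equality
      toℚᵘ (fromℕ (suc n))            ≃⟨ toℚᵘ-/ (+ suc n) 1 ⟩
      + suc n ℚᵘ./ 1                  ≃⟨ ℚᵘ.*≡* (cong (ℤ._* + 1) (sym (cong (ℤ._+_ (+ 1)) (ℤ.*-identityʳ (+ n))))) ⟩
      ℚᵘ.1ℚᵘ ℚᵘ.+ (+ n ℚᵘ./ 1)        ≃⟨ ℚᵘ.+-congʳ ℚᵘ.1ℚᵘ (toℚᵘ-/ (+ n) 1) ⟨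
      ℚᵘ.1ℚᵘ ℚᵘ.+ toℚᵘ (fromℕ n)      ≃⟨ toℚᵘ-homo-+ 1ℚ (fromℕ n) ⟨
      toℚᵘ (1ℚ + fromℕ n)             ∎)

    fromℕ-* : ∀ m n → fromℕ (m ℕ.* n) ≡ fromℕ m * fromℕ n
    fromℕ-* m n = toℚᵘ-injective (begin-equality
      toℚᵘ (fromℕ (m ℕ.* n))                  ≃⟨ toℚᵘ-/ (+ (m ℕ.* n)) 1 ⟩
      + (m ℕ.* n) ℚᵘ./ 1                      ≃⟨ ℚᵘ.*≡* (cong (ℤ._* + 1) (ℤ.pos-* m n)) ⟩
      (+ m ℚᵘ./ 1) ℚᵘ.* (+ n ℚᵘ./ 1)          ≃⟨ ℚᵘ.*-cong (toℚᵘ-/ (+ m) 1) (toℚᵘ-/ (+ n) 1) ⟨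
      toℚᵘ (fromℕ m) ℚᵘ.* toℚᵘ (fromℕ n)      ≃⟨ toℚᵘ-homo-* (fromℕ m) (fromℕ n) ⟨
      toℚᵘ (fromℕ m * fromℕ n)                ∎)

    fromℕ-*-/ : ∀ i n .{{_ : NonZero n}} → fromℕ n * (i / n) ≡ i / 1
    fromℕ-*-/ i n@(suc _) = toℚᵘ-injective (begin-equality
      toℚᵘ (fromℕ n * (i / n))                ≃⟨ toℚᵘ-homo-* (fromℕ n) (i / n) ⟩
      toℚᵘ (fromℕ n) ℚᵘ.* toℚᵘ (i / n)        ≃⟨ ℚᵘ.*-cong (toℚᵘ-/ (+ n) 1) (toℚᵘ-/ i n) ⟩
      (+ n ℚᵘ./ 1) ℚᵘ.* (i ℚᵘ./ n)            ≃⟨ ℚᵘ.*≡* (trans (ℤ.*-identityʳ _) (trans (ℤ.*-comm (+ n) i) (cong (λ d → i ℤ.* + d) (sym (ℕ.*-identityˡ n))))) ⟩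
      i ℚᵘ./ 1                                ≃⟨ toℚᵘ-/ i 1 ⟨
      toℚᵘ (i / 1)                            ∎)

  open Fractions
  open ≡-Reasoning

  -- The inserted factor `B * 1/b`, equal to 1, completes `C` to `fromℕ a`, which cancels `1/a`.
  -- Taking the factorisation as a hypothesis covers both k! and mᵏ k!.
  1/-* : ∀ {a b c} .{{_ : NonZero a}} .{{_ : NonZero b}} → a ≡ c ℕ.* b →
         (+ 1 / a) * fromℕ c ≡ + 1 / b
  1/-* {a} {b} {c} a≡cb = begin
    1/a * C              ≡⟨ *-identityʳ _ ⟨
    1/a * C * 1ℚ         ≡⟨ cong ((1/a * C) *_) (fromℕ-*-/ (+ 1) b) ⟨
    1/a * C * (B * 1/b)  ≡⟨ solve 4 (λ x c b y → x :* c :* (b :* y) := (c :* b) :* x :* y) refl 1/a C B 1/b ⟩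
    (C * B) * 1/a * 1/b  ≡⟨ cong (λ x → x * 1/a * 1/b) (trans (cong fromℕ a≡cb) (fromℕ-* c b)) ⟨
    fromℕ a * 1/a * 1/b  ≡⟨ cong (_* 1/b) (fromℕ-*-/ (+ 1) a) ⟩
    1ℚ * 1/b             ≡⟨ *-identityˡ 1/b ⟩
    1/b                  ∎
    where
    1/a = + 1 / a
    1/b = + 1 / b
    B = fromℕ b
    C = fromℕ c

  1/!-suc : ∀ n → 1/ (suc n) ! * fromℕ (suc n) ≡ 1/ n !
  1/!-suc n = 1/-* {c = suc n} {{suc n ℕ.!≢0}} {{n ℕ.!≢0}} refl

  -- The induction rests on `(f ⊗ h) (suc n)` computing to `f 0 * h (suc n) + (f ∘ suc ⊗ h) n`. The
  -- combination is assumed pointwise, which avoids function extensionality.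
  ⊗-linearˡ : ∀ {p f g : Series} a b h → (∀ i → p i ≡ a * f i + b * g i) →
              ∀ n → (p ⊗ h) n ≡ a * (f ⊗ h) n + b * (g ⊗ h) n
  ⊗-linearˡ {p} {f} {g} a b h eq zero = begin
    p 0 * h 0 + 0ℚ                    ≡⟨ cong (λ x → x * h 0 + 0ℚ) (eq 0) ⟩
    (a * f 0 + b * g 0) * h 0 + 0ℚ
      ≡⟨ solve 5 (λ a b f g h → (a :* f :+ b :* g) :* h :+ con 0
                   := a :* (f :* h :+ con 0) :+ b :* (g :* h :+ con 0)) refl a b (f 0) (g 0) (h 0) ⟩
    a * (f 0 * h 0 + 0ℚ) + b * (g 0 * h 0 + 0ℚ) ∎
  ⊗-linearˡ {p} {f} {g} a b h eq (suc n) = begin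
    p 0 * h (suc n) + (p ∘ suc ⊗ h) n
      ≡⟨ cong₂ (λ x y → x * h (suc n) + y) (eq 0) (⊗-linearˡ {p ∘ suc} {f ∘ suc} {g ∘ suc} a b h (eq ∘ suc) n) ⟩
    (a * f 0 + b * g 0) * h (suc n) + (a * (f ∘ suc ⊗ h) n + b * (g ∘ suc ⊗ h) n)
      ≡⟨ solve 7 (λ a b f g h x y → (a :* f :+ b :* g) :* h :+ (a :* x :+ b :* y)
                   := a :* (f :* h :+ x) :+ b :* (g :* h :+ y)) refl
           a b (f 0) (g 0) (h (suc n)) ((f ∘ suc ⊗ h) n) ((g ∘ suc ⊗ h) n) ⟩
    a * (f 0 * h (suc n) + (f ∘ suc ⊗ h) n) + b * (g 0 * h (suc n) + (g ∘ suc ⊗ h) n) ∎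

  ⊗-linearʳ : ∀ {p f g : Series} a b h → (∀ i → p i ≡ a * f i + b * g i) →
              ∀ n → (h ⊗ p) n ≡ a * (h ⊗ f) n + b * (h ⊗ g) n
  ⊗-linearʳ {p} {f} {g} a b h eq zero = begin
    h 0 * p 0 + 0ℚ                    ≡⟨ cong (λ x → h 0 * x + 0ℚ) (eq 0) ⟩
    h 0 * (a * f 0 + b * g 0) + 0ℚ
      ≡⟨ solve 5 (λ a b f g h → h :* (a :* f :+ b :* g) :+ con 0
                   := a :* (h :* f :+ con 0) :+ b :* (h :* g :+ con 0)) refl a b (f 0) (g 0) (h 0) ⟩
    a * (h 0 * f 0 + 0ℚ) + b * (h 0 * g 0 + 0ℚ) ∎
  ⊗-linearʳ {p} {f} {g} a b h eq (suc n) = begin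
    h 0 * p (suc n) + (h ∘ suc ⊗ p) n
      ≡⟨ cong₂ (λ x y → h 0 * x + y) (eq (suc n)) (⊗-linearʳ {p} {f} {g} a b (h ∘ suc) eq n) ⟩
    h 0 * (a * f (suc n) + b * g (suc n)) + (a * (h ∘ suc ⊗ f) n + b * (h ∘ suc ⊗ g) n)
      ≡⟨ solve 7 (λ a b f g h x y → h :* (a :* f :+ b :* g) :+ (a :* x :+ b :* y)
                   := a :* (h :* f :+ x) :+ b :* (h :* g :+ y)) refl
           a b (f (suc n)) (g (suc n)) (h 0) ((h ∘ suc ⊗ f) n) ((h ∘ suc ⊗ g) n) ⟩
    a * (h 0 * f (suc n) + (h ∘ suc ⊗ f) n) + b * (h 0 * g (suc n) + (h ∘ suc ⊗ g) n) ∎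

  ⊗-identityˡ : ∀ f n → (one ⊗ f) n ≡ f n
  ⊗-identityˡ f zero    = trans (+-identityʳ _) (*-identityˡ (f 0))
  ⊗-identityˡ f (suc n) = begin
    1ℚ * f (suc n) + (0̂ ⊗ f) n
      -- Linearity with both scalars 0 makes the product with the zero series vanish.
      ≡⟨ cong (λ y → 1ℚ * f (suc n) + y) (⊗-linearˡ {0̂} {0̂} {0̂} 0ℚ 0ℚ f (λ _ → refl) n) ⟩
    1ℚ * f (suc n) + (0ℚ * (0̂ ⊗ f) n + 0ℚ * (0̂ ⊗ f) n)
      ≡⟨ solve 2 (λ x y → con 1 :* x :+ (con 0 :* y :+ con 0 :* y) := x) refl (f (suc n)) ((0̂ ⊗ f) n) ⟩
    f (suc n) ∎
    where
    0̂ : Series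
    0̂ _ = 0ℚ

  -- Derivations on series

  euler deriv : Series → Series
  euler f n = fromℕ n * f n
  deriv f n = fromℕ (suc n) * f (suc n)

  -- Leibniz rule for z d/dz, proved before that for d/dz because this operator keeps the index and
  -- so fits the recursion of `_⊗_`. The factor n+1 on the tail splits as 1 + n: the n feeds the
  -- induction, the 1 turns `euler (f ∘ suc)` into `deriv f`.
  euler-⊗ : ∀ f g n → euler (f ⊗ g) n ≡ (euler f ⊗ g) n + (f ⊗ euler g) n
  euler-⊗ f g zero = solve 2 (λ x y → con 0 :* (x :* y :+ con 0)
    := (con 0 :* x) :* y :+ con 0 :+ (x :* (con 0 :* y) :+ con 0)) refl (f 0) (g 0)
  euler-⊗ f g (suc n) = begin
    fromℕ (suc n) * (x * y + c)
      ≡⟨ *-distribˡ-+ (fromℕ (suc n)) (x * y) c ⟩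
    fromℕ (suc n) * (x * y) + fromℕ (suc n) * c
      ≡⟨ cong (λ z → fromℕ (suc n) * (x * y) + z * c) (fromℕ-suc n) ⟩
    fromℕ (suc n) * (x * y) + (1ℚ + fromℕ n) * c
      ≡⟨ solve 5 (λ s x y c k → s :* (x :* y) :+ (con 1 :+ k) :* c := x :* (s :* y) :+ (c :+ k :* c))
           refl (fromℕ (suc n)) x y c (fromℕ n) ⟩
    x * (fromℕ (suc n) * y) + (c + fromℕ n * c)
      ≡⟨ cong (λ z → x * (fromℕ (suc n) * y) + (c + z)) (euler-⊗ (f ∘ suc) g n) ⟩
    x * (fromℕ (suc n) * y) + (c + (d + e))
      ≡⟨ solve 6 (λ s x y c d e → x :* (s :* y) :+ (c :+ (d :+ e))
                    := con 0 :* x :* y :+ (con 1 :* c :+ con 1 :* d) :+ (x :* (s :* y) :+ e))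
           refl (fromℕ (suc n)) x y c d e ⟩
    0ℚ * x * y + (1ℚ * c + 1ℚ * d) + (x * (fromℕ (suc n) * y) + e)
      ≡⟨ cong (λ z → 0ℚ * x * y + z + (x * (fromℕ (suc n) * y) + e))
           (⊗-linearˡ {deriv f} {f ∘ suc} {euler (f ∘ suc)} 1ℚ 1ℚ g deriv-euler n) ⟨
    0ℚ * x * y + (deriv f ⊗ g) n + (x * (fromℕ (suc n) * y) + e) ∎
    where
    x = f 0
    y = g (suc n)
    c = (f ∘ suc ⊗ g) n
    d = (euler (f ∘ suc) ⊗ g) n
    e = (f ∘ suc ⊗ euler g) n
    deriv-euler : ∀ i → deriv f i ≡ 1ℚ * f (suc i) + 1ℚ * euler (f ∘ suc) i
    deriv-euler i = trans (cong (_* f (suc i)) (fromℕ-suc i))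
      (solve 2 (λ k x → (con 1 :+ k) :* x := con 1 :* x :+ con 1 :* (k :* x)) refl (fromℕ i) (f (suc i)))

  ⊗-euler-suc : ∀ f g n → (f ⊗ euler g) (suc n) ≡ (f ⊗ deriv g) n
  ⊗-euler-suc f g zero    = solve 4 (λ x y z w → x :* y :+ (z :* (con 0 :* w) :+ con 0) := x :* y :+ con 0)
    refl (f 0) (deriv g 0) (f 1) (g 0)
  ⊗-euler-suc f g (suc n) = cong (λ z → (f 0 * deriv g (suc n)) + z) (⊗-euler-suc (f ∘ suc) g n)

  -- `deriv f n` is `euler f (suc n)` by definition, so this is `euler-⊗` one index higher; the
  -- boundary terms carry the factor 0.
  deriv-⊗ : ∀ f g n → deriv (f ⊗ g) n ≡ (deriv f ⊗ g) n + (f ⊗ deriv g) n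
  deriv-⊗ f g n = begin
    deriv (f ⊗ g) n                                       ≡⟨ euler-⊗ f g (suc n) ⟩
    0ℚ * f 0 * g (suc n) + x + (f ⊗ euler g) (suc n)
      ≡⟨ cong₂ (λ u v → u * g (suc n) + x + v) (*-zeroˡ (f 0)) (⊗-euler-suc f g n) ⟩
    0ℚ * g (suc n) + x + y
      ≡⟨ solve 3 (λ g x y → con 0 :* g :+ x :+ y := x :+ y) refl (g (suc n)) x y ⟩
    x + y ∎
    where
    x = (deriv f ⊗ g) n
    y = (f ⊗ deriv g) n

  -- (1 + sz) f′
  θ : ℚ → Series → Series
  θ s f n = deriv f n + s * euler f n

  θ-⊗ : ∀ s f g n → θ s (f ⊗ g) n ≡ (θ s f ⊗ g) n + (f ⊗ θ s g) n
  θ-⊗ s f g n = begin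
    deriv (f ⊗ g) n + s * euler (f ⊗ g) n
      ≡⟨ cong₂ (λ x y → x + s * y) (deriv-⊗ f g n) (euler-⊗ f g n) ⟩
    (a + b) + s * (c + d)
      ≡⟨ solve 5 (λ s a b c d → (a :+ b) :+ s :* (c :+ d)
           := (con 1 :* a :+ s :* c) :+ (con 1 :* b :+ s :* d)) refl s a b c d ⟩
    (1ℚ * a + s * c) + (1ℚ * b + s * d)
      ≡⟨ cong₂ _+_
           (⊗-linearˡ {θ s f} {deriv f} {euler f} 1ℚ s g (λ i → cong (_+ s * euler f i) (sym (*-identityˡ (deriv f i)))) n)
           (⊗-linearʳ {θ s g} {deriv g} {euler g} 1ℚ s f (λ i → cong (_+ s * euler g i) (sym (*-identityˡ (deriv g i)))) n) ⟨
    (θ s f ⊗ g) n + (f ⊗ θ s g) n ∎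
    where
    a = (deriv f ⊗ g) n
    b = (f ⊗ deriv g) n
    c = (euler f ⊗ g) n
    d = (f ⊗ euler g) n

  θ-one : ∀ s n → θ s one n ≡ 0ℚ
  θ-one s zero    = solve 1 (λ s → con 1 :* con 0 :+ s :* (con 0 :* con 1) := con 0) refl s
  θ-one s (suc n) = solve 3 (λ s x y → x :* con 0 :+ s :* (y :* con 0) := con 0) refl s (fromℕ (suc (suc n))) (fromℕ (suc n))

  -- ln(1+mz) satisfies the hypothesis with s = c = m, d = 0; (e^(mz) − 1)/m with s = 0, c = 1, d = m.
  module SeriesPowers (s c d : ℚ) (L : Series)
                      (θL : ∀ n → θ s L n ≡ c * one n + d * L n) where

    -- The factor `fromℕ k` disposes of k = 0, where the default value would otherwise have to be
    -- pulled out of the product; for k > 0 both sides compute to the same term.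
    fromℕ-⊗-◂ : ∀ (P : Series) k n →
      fromℕ k * (P ⊗ (λ i → (0ℚ ◂ λ j → (L ^^ j) i) k)) n ≡ fromℕ k * (0ℚ ◂ λ j → (P ⊗ L ^^ j) n) k
    fromℕ-⊗-◂ P zero    n = *-zeroˡ ((P ⊗ (λ _ → 0ℚ)) n)
    fromℕ-⊗-◂ P (suc k) n = refl

    -- The formula for `θ s (L ^^ k)` is a hypothesis so that this can serve inside the induction
    -- proving it (with `P` = `L`) and again afterwards.
    ⊗-θ-^^ : (P : Series) (k : ℕ) →
      (∀ n → θ s (L ^^ k) n ≡ fromℕ k * (c * (0ℚ ◂ λ j → (L ^^ j) n) k + d * (L ^^ k) n)) →
      ∀ n → (P ⊗ θ s (L ^^ k)) n
          ≡ fromℕ k * (c * (0ℚ ◂ λ j → (P ⊗ L ^^ j) n) k + d * (P ⊗ L ^^ k) n)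
    ⊗-θ-^^ P k eq n = begin
      (P ⊗ θ s (L ^^ k)) n
        ≡⟨ ⊗-linearʳ {θ s (L ^^ k)} {λ i → (0ℚ ◂ λ j → (L ^^ j) i) k} {L ^^ k} (c * K) (d * K) P
             (λ i → trans (eq i) (expand K c d ((0ℚ ◂ λ j → (L ^^ j) i) k) ((L ^^ k) i))) n ⟩
      c * K * X + d * K * Y   ≡⟨ solve 5 (λ c d k x y → c :* k :* x :+ d :* k :* y := c :* (k :* x) :+ k :* (d :* y)) refl c d K X Y ⟩
      c * (K * X) + K * (d * Y) ≡⟨ cong (λ z → c * z + K * (d * Y)) (fromℕ-⊗-◂ P k n) ⟩
      c * (K * Z) + K * (d * Y) ≡⟨ solve 5 (λ c d k x y → c :* (k :* x) :+ k :* (d :* y) := k :* (c :* x :+ d :* y)) refl c d K Z Y ⟩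
      K * (c * Z + d * Y) ∎
      where
      K = fromℕ k
      X = (P ⊗ (λ i → (0ℚ ◂ λ j → (L ^^ j) i) k)) n
      Y = (P ⊗ L ^^ k) n
      Z = (0ℚ ◂ λ j → (P ⊗ L ^^ j) n) k
      expand : ∀ k c d x y → k * (c * x + d * y) ≡ c * k * x + d * k * y
      expand = solve 5 (λ k c d x y → k :* (c :* x :+ d :* y) := c :* k :* x :+ d :* k :* y) refl

    -- By Leibniz on L · Lᵏ, the factor `θ s L` contributes one copy of c Lᵏ + d Lᵏ⁺¹ and the
    -- induction hypothesis k more.
    θ-^^ : ∀ k n → θ s (L ^^ k) n ≡ fromℕ k * (c * (0ℚ ◂ λ j → (L ^^ j) n) k + d * (L ^^ k) n)
    θ-^^ zero    n = trans (θ-one s n) (sym (*-zeroˡ (c * 0ℚ + d * one n)))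
    θ-^^ (suc k) n = begin
      θ s (L ⊗ L ^^ k) n
        ≡⟨ θ-⊗ s L (L ^^ k) n ⟩
      (θ s L ⊗ L ^^ k) n + (L ⊗ θ s (L ^^ k)) n
        ≡⟨ cong₂ _+_ (⊗-linearˡ {θ s L} {one} {L} c d (L ^^ k) θL n) (⊗-θ-^^ L k (θ-^^ k) n) ⟩
      c * (one ⊗ L ^^ k) n + d * Y + K * (c * (0ℚ ◂ λ j → (L ⊗ L ^^ j) n) k + d * Y)
        ≡⟨ cong (λ z → c * z + d * Y + K * (c * (0ℚ ◂ λ j → (L ⊗ L ^^ j) n) k + d * Y)) (⊗-identityˡ (L ^^ k) n) ⟩
      c * X + d * Y + K * (c * (0ℚ ◂ λ j → (L ⊗ L ^^ j) n) k + d * Y)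
        ≡⟨ cong (λ z → (c * X + d * Y) + z) (shift k) ⟩
      c * X + d * Y + K * (c * X + d * Y)
        ≡⟨ solve 2 (λ k z → z :+ k :* z := (con 1 :+ k) :* z) refl K (c * X + d * Y) ⟩
      (1ℚ + K) * (c * X + d * Y)
        ≡⟨ cong (_* (c * X + d * Y)) (fromℕ-suc k) ⟨
      fromℕ (suc k) * (c * X + d * Y) ∎
      where
      K = fromℕ k
      X = (L ^^ k) n
      Y = (L ^^ suc k) n
      shift : ∀ k → fromℕ k * (c * (0ℚ ◂ λ j → (L ⊗ L ^^ j) n) k + d * Y) ≡ fromℕ k * (c * (L ^^ k) n + d * Y)
      shift zero    = trans (*-zeroˡ (c * 0ℚ + d * Y)) (sym (*-zeroˡ (c * one n + d * Y)))
      shift (suc k) = refl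

    -- `P` is an eigenvector of θ: (1+mz)^(-r/m) with a = -r for the first kind, e^(rz) with a = r
    -- for the second. The condition on `q` is that of the normalisation 1/(cᵏ k!).
    module _ (a : ℚ) (P : Series) (θP : ∀ n → θ s P n ≡ a * P n)
             (q : ℕ → ℚ) (q-suc : ∀ k → q (suc k) * (fromℕ (suc k) * c) ≡ q k) where

      θ-⊗-^^ : ∀ k n → θ s (P ⊗ L ^^ k) n
             ≡ a * (P ⊗ L ^^ k) n + fromℕ k * (c * (0ℚ ◂ λ j → (P ⊗ L ^^ j) n) k + d * (P ⊗ L ^^ k) n)
      θ-⊗-^^ k n = begin
        θ s (P ⊗ L ^^ k) n                          ≡⟨ θ-⊗ s P (L ^^ k) n ⟩
        (θ s P ⊗ L ^^ k) n + (P ⊗ θ s (L ^^ k)) n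
          ≡⟨ cong₂ _+_ (⊗-linearˡ {θ s P} {P} {P} a 0ℚ (L ^^ k)
                          (λ i → trans (θP i) (add-zero a (P i))) n)
                       (⊗-θ-^^ P k (θ-^^ k) n) ⟩
        a * X + 0ℚ * X + Z                          ≡⟨ cong (_+ Z) (add-zero a X) ⟨
        a * X + Z                                   ∎
        where
        X = (P ⊗ L ^^ k) n
        Z = fromℕ k * (c * (0ℚ ◂ λ j → (P ⊗ L ^^ j) n) k + d * X)
        add-zero : ∀ a x → a * x ≡ a * x + 0ℚ * x
        add-zero = solve 2 (λ a x → a :* x := a :* x :+ con 0 :* x) refl

      coeff : ℕ → ℕ → ℚ
      coeff n k = egfCoeff (q k • (P ⊗ L ^^ k)) n

      -- Multiplying `θ-⊗-^^` by n! q(k): on the sequence of an exponential generating function, f′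
      -- shifts the index and z f′ multiplies by n, while `q-suc` turns q(k) k c into q(k-1).
      coeff-rec : ∀ n k → coeff (suc n) k + s * fromℕ n * coeff n k
                        ≡ (a + d * fromℕ k) * coeff n k + (0ℚ ◂ coeff n) k
      coeff-rec n k = begin
        fromℕ (suc n !) * (q k * X′) + s * fromℕ n * (F * (q k * X))
          ≡⟨ cong (λ z → z * (q k * X′) + s * fromℕ n * (F * (q k * X))) (fromℕ-* (suc n) (n !)) ⟩
        fromℕ (suc n) * F * (q k * X′) + s * fromℕ n * (F * (q k * X))
          ≡⟨ solve 7 (λ m f q x′ s n x → m :* f :* (q :* x′) :+ s :* n :* (f :* (q :* x))
                        := f :* q :* (m :* x′ :+ s :* (n :* x)))
               refl (fromℕ (suc n)) F (q k) X′ s (fromℕ n) X ⟩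
        F * q k * θ s (P ⊗ L ^^ k) n
          ≡⟨ cong ((F * q k) *_) (θ-⊗-^^ k n) ⟩
        F * q k * (a * X + K * (c * Z + d * X))
          ≡⟨ solve 8 (λ f q a x k c z d → f :* q :* (a :* x :+ k :* (c :* z :+ d :* x))
                        := (a :+ d :* k) :* (f :* (q :* x)) :+ f :* (q :* (k :* c) :* z))
               refl F (q k) a X K c Z d ⟩
        (a + d * K) * (F * (q k * X)) + F * (q k * (K * c) * Z)
          ≡⟨ cong (λ z → ((a + d * K) * (F * (q k * X))) + z) (lower k) ⟩
        (a + d * K) * (F * (q k * X)) + (0ℚ ◂ coeff n) k ∎
        where
        F = fromℕ (n !)
        K = fromℕ k
        X  = (P ⊗ L ^^ k) n
        X′ = (P ⊗ L ^^ k) (suc n)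
        Z = (0ℚ ◂ λ j → (P ⊗ L ^^ j) n) k
        lower : ∀ k → F * (q k * (fromℕ k * c) * (0ℚ ◂ λ j → (P ⊗ L ^^ j) n) k) ≡ (0ℚ ◂ coeff n) k
        lower zero    = solve 3 (λ f q c → f :* (q :* (con 0 :* c) :* con 0) := con 0) refl F (q 0) c
        lower (suc k) = cong (λ z → F * (z * (P ⊗ L ^^ k) n)) (q-suc k)

      module _ (P₀ : P 0 ≡ 1ℚ) (L₀ : L 0 ≡ 0ℚ) (q₀ : q 0 ≡ 1ℚ) where

        coeff-zero : ∀ k → coeff 0 k ≡ (1ℚ ◂ λ _ → 0ℚ) k
        coeff-zero zero    = cong₂ (λ x y → 1ℚ * (y * (x * 1ℚ + 0ℚ))) P₀ q₀
        coeff-zero (suc k) = begin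
          1ℚ * (q (suc k) * (P 0 * (L 0 * (L ^^ k) 0 + 0ℚ) + 0ℚ))
            ≡⟨ cong (λ l → 1ℚ * (q (suc k) * (P 0 * (l * (L ^^ k) 0 + 0ℚ) + 0ℚ))) L₀ ⟩
          1ℚ * (q (suc k) * (P 0 * (0ℚ * (L ^^ k) 0 + 0ℚ) + 0ℚ))
            ≡⟨ solve 3 (λ q p x → con 1 :* (q :* (p :* (con 0 :* x :+ con 0) :+ con 0)) := con 0)
                 refl (q (suc k)) (P 0) ((L ^^ k) 0) ⟩
          0ℚ ∎

  -- Recurrences of the Whitney numbers of both kinds

  module Whitney (m : ℕ) .{{_ : NonZero m}} (r : ℕ) where

    M ρ : ℚ
    M = fromℕ m
    ρ = fromℕ r

    deriv-dilate-exp : ∀ k n → deriv (dilate k exp) n ≡ k * dilate k exp n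
    deriv-dilate-exp k n = begin
      N * ((k * k ^ n) * 1/ (suc n) !)
        ≡⟨ solve 4 (λ n k p e → n :* ((k :* p) :* e) := k :* (p :* (e :* n))) refl N k (k ^ n) (1/ (suc n) !) ⟩
      k * (k ^ n * (1/ (suc n) ! * N))
        ≡⟨ cong (λ z → k * (k ^ n * z)) (1/!-suc n) ⟩
      k * (k ^ n * 1/ n !) ∎
      where N = fromℕ (suc n)

    pow : Series
    pow = dilate M ([1+z]^ (- (+ r / m)))

    θ-pow : ∀ n → θ M pow n ≡ - ρ * pow n
    θ-pow n = begin
      N′ * ((M * Mⁿ) * ((F * β) * e′)) + M * (N * (Mⁿ * (F * e)))
        ≡⟨ solve 8 (λ n′ m p f b e′ n e → n′ :* ((m :* p) :* ((f :* b) :* e′)) :+ m :* (n :* (p :* (f :* e)))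
                     := m :* p :* f :* (b :* (e′ :* n′) :+ n :* e)) refl N′ M Mⁿ F β e′ N e ⟩
      M * Mⁿ * F * (β * (e′ * N′) + N * e)
        ≡⟨ cong (λ z → M * Mⁿ * F * (β * z + N * e)) (1/!-suc n) ⟩
      M * Mⁿ * F * (β * e + N * e)
        ≡⟨ solve 6 (λ m p f b e n → m :* p :* f :* (b :* e :+ n :* e) := m :* (b :+ n) :* (p :* (f :* e)))
             refl M Mⁿ F β e N ⟩
      M * (β + N) * pow n
        -- The new factor α - n of the falling factorial meets the n coming from z f′, and only α
        -- remains.
        ≡⟨ cong (λ z → M * z * pow n) (trans (+-assoc α (- N) N) (trans (cong (λ z → α + z) (+-inverseˡ N)) (+-identityʳ α))) ⟩
      M * α * pow n
        ≡⟨ cong (_* pow n) (trans (sym (neg-distribʳ-* M (+ r / m))) (cong -_ (fromℕ-*-/ (+ r) m))) ⟩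
      - ρ * pow n ∎
      where
      α = - (+ r / m)
      N = fromℕ n
      N′ = fromℕ (suc n)
      Mⁿ = M ^ n
      F = falling α n
      β = α - N
      e = 1/ n !
      e′ = 1/ (suc n) !

    log : Series
    log = dilate M log1+

    -- The factor n+1 cancels the denominator in `log1+`, leaving the geometric series of m/(1+mz),
    -- which θ collapses to the constant m.
    deriv-log : ∀ n → deriv log n ≡ M * (M ^ n * (- 1ℚ) ^ n)
    deriv-log n = begin
      N * ((M * M ^ n) * ((- 1ℚ) ^ n * i))
        ≡⟨ solve 5 (λ n m p s i → n :* ((m :* p) :* (s :* i)) := m :* (p :* s) :* (n :* i)) refl N M (M ^ n) ((- 1ℚ) ^ n) i ⟩
      M * (M ^ n * (- 1ℚ) ^ n) * (N * i)
        ≡⟨ cong (λ z → M * (M ^ n * (- 1ℚ) ^ n) * z) (fromℕ-*-/ (+ 1) (suc n)) ⟩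
      M * (M ^ n * (- 1ℚ) ^ n) * 1ℚ
        ≡⟨ *-identityʳ _ ⟩
      M * (M ^ n * (- 1ℚ) ^ n) ∎
      where
      N = fromℕ (suc n)
      i = + 1 / suc n

    θ-log : ∀ n → θ M log n ≡ M * one n + 0ℚ * log n
    θ-log zero = begin
      deriv log 0 + M * (0ℚ * log 0)  ≡⟨ cong (_+ M * (0ℚ * log 0)) (deriv-log 0) ⟩
      M * (1ℚ * 1ℚ) + M * (0ℚ * log 0)
        ≡⟨ solve 2 (λ m l → m :* (con 1 :* con 1) :+ m :* (con 0 :* l) := m :* con 1 :+ con 0 :* l) refl M (log 0) ⟩
      M * 1ℚ + 0ℚ * log 0 ∎
    θ-log (suc n) = begin
      deriv log (suc n) + M * deriv log n
        ≡⟨ cong₂ (λ x y → x + M * y) (deriv-log (suc n)) (deriv-log n) ⟩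
      M * (M * p * (- 1ℚ * s)) + M * (M * (p * s))
        -- The semiring solver treats -1 as a variable t; the resulting factor t + 1 then evaluates
        -- to `0ℚ`.
        ≡⟨ solve 4 (λ m p s t → m :* (m :* p :* (t :* s)) :+ m :* (m :* (p :* s)) := m :* m :* p :* s :* (t :+ con 1))
             refl M p s (- 1ℚ) ⟩
      M * M * p * s * 0ℚ
        ≡⟨ solve 3 (λ x m l → x :* con 0 := m :* con 0 :+ con 0 :* l) refl (M * M * p * s) M (log (suc n)) ⟩
      M * 0ℚ + 0ℚ * log (suc n) ∎
      where
      p = M ^ n
      s = (- 1ℚ) ^ n

    coeff₁ : ℕ → ℚ
    coeff₁ k = _/_ (+ 1) (m ℕ.^ k ℕ.* k !) {{ℕ.m*n≢0 (m ℕ.^ k) (k !) {{ℕ.m^n≢0 m k}} {{k ℕ.!≢0}}}}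

    coeff₁-suc : ∀ k → coeff₁ (suc k) * (fromℕ (suc k) * M) ≡ coeff₁ k
    coeff₁-suc k = trans (cong (coeff₁ (suc k) *_) (sym (fromℕ-* (suc k) m)))
      (1/-* {c = suc k ℕ.* m}
         {{ℕ.m*n≢0 (m ℕ.^ suc k) (suc k !) {{ℕ.m^n≢0 m (suc k)}} {{suc k ℕ.!≢0}}}}
         {{ℕ.m*n≢0 (m ℕ.^ k) (k !) {{ℕ.m^n≢0 m k}} {{k ℕ.!≢0}}}}
         (ℕsolve 4 (λ m p k f → (m ⊛ p) ⊛ (k ⊛ f) ⊜ k ⊛ m ⊛ (p ⊛ f)) refl m (m ℕ.^ k) (suc k) (k !)))
      where open +-*-Solver using () renaming (solve to ℕsolve; _:*_ to infixl 7 _⊛_; _:=_ to infix 4 _⊜_)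

    -- The nodes `c` of `Orthogonality`, shared by both kinds: taken at the row index for `whitney₁`
    -- and at the column index for `whitney₂`.
    node : ℕ → ℚ
    node j = ρ + M * fromℕ j

    module LogPowers = SeriesPowers M M 0ℚ log θ-log

    whitney₁-zero : ∀ k → whitney₁ m r 0 k ≡ (1ℚ ◂ λ _ → 0ℚ) k
    whitney₁-zero = LogPowers.coeff-zero (- ρ) pow θ-pow coeff₁ coeff₁-suc refl (*-zeroʳ 1ℚ) refl

    -- Here `coeff-rec` has a = -r and d = 0; the term -r w moves to the left and joins m n w.
    whitney₁-rec : ∀ n k → whitney₁ m r (suc n) k + node n * whitney₁ m r n k ≡ (0ℚ ◂ whitney₁ m r n) k
    whitney₁-rec n k = begin
      w′ + (ρ + M * fromℕ n) * w
        ≡⟨ solve 4 (λ a p x w → a :+ (p :+ x) :* w := (a :+ x :* w) :+ p :* w) refl w′ ρ (M * fromℕ n) w ⟩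
      (w′ + M * fromℕ n * w) + ρ * w
        ≡⟨ cong (_+ ρ * w) (LogPowers.coeff-rec (- ρ) pow θ-pow coeff₁ coeff₁-suc n k) ⟩
      ((- ρ + 0ℚ * fromℕ k) * w + v) + ρ * w
        ≡⟨ solve 5 (λ s k w v p → (s :+ con 0 :* k) :* w :+ v :+ p :* w := (s :+ p) :* w :+ v) refl (- ρ) (fromℕ k) w v ρ ⟩
      (- ρ + ρ) * w + v
        ≡⟨ cong (λ z → z * w + v) (+-inverseˡ ρ) ⟩
      0ℚ * w + v
        ≡⟨ trans (cong (_+ v) (*-zeroˡ w)) (+-identityˡ v) ⟩
      v ∎
      where
      w′ = whitney₁ m r (suc n) k
      w = whitney₁ m r n k
      v = (0ℚ ◂ whitney₁ m r n) k

    expm1 : Series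
    expm1 = (+ 1 / m) • (dilate M exp ⊖ one)

    θ-expm1 : ∀ n → θ 0ℚ expm1 n ≡ 1ℚ * one n + M * expm1 n
    θ-expm1 n = begin
      N * (i * (dilate M exp (suc n) + 0ℚ)) + 0ℚ * (fromℕ n * expm1 n)
        ≡⟨ solve 5 (λ n i e k x → n :* (i :* (e :+ con 0)) :+ con 0 :* (k :* x) := i :* (n :* e))
             refl N i (dilate M exp (suc n)) (fromℕ n) (expm1 n) ⟩
      i * deriv (dilate M exp) n
        ≡⟨ cong (i *_) (deriv-dilate-exp M n) ⟩
      i * (M * e)
        ≡⟨ solve 3 (λ i m e → i :* (m :* e) := m :* i :* e) refl i M e ⟩
      M * i * e
        ≡⟨ cong (_* e) Mi≡1 ⟩
      1ℚ * e
        -- The derivative e^(mz) is rewritten as 1 + (e^(mz) - 1) to recover `expm1`.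
        ≡⟨ cong (1ℚ *_) (trans (sym (+-identityʳ e)) (cong (λ z → e + z) (sym (+-inverseˡ (one n))))) ⟩
      1ℚ * (e + (- one n + one n))
        ≡⟨ solve 3 (λ e s o → con 1 :* (e :+ (s :+ o)) := con 1 :* o :+ con 1 :* (e :+ s)) refl e (- one n) (one n) ⟩
      1ℚ * one n + 1ℚ * (e - one n)
        ≡⟨ cong (λ z → 1ℚ * one n + z * (e - one n)) Mi≡1 ⟨
      1ℚ * one n + M * i * (e - one n)
        ≡⟨ cong (λ z → 1ℚ * one n + z) (*-assoc M i (e - one n)) ⟩
      1ℚ * one n + M * expm1 n ∎
      where
      N = fromℕ (suc n)
      i = + 1 / m
      e = dilate M exp n
      Mi≡1 : M * i ≡ 1ℚ
      Mi≡1 = fromℕ-*-/ (+ 1) m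

    θ-dilate-exp : ∀ n → θ 0ℚ (dilate ρ exp) n ≡ ρ * dilate ρ exp n
    θ-dilate-exp n = begin
      deriv (dilate ρ exp) n + 0ℚ * euler (dilate ρ exp) n  ≡⟨ cong (λ z → deriv (dilate ρ exp) n + z) (*-zeroˡ (euler (dilate ρ exp) n)) ⟩
      deriv (dilate ρ exp) n + 0ℚ                           ≡⟨ +-identityʳ _ ⟩
      deriv (dilate ρ exp) n                                ≡⟨ deriv-dilate-exp ρ n ⟩
      ρ * dilate ρ exp n                                    ∎

    coeff₂ : ℕ → ℚ
    coeff₂ k = 1/ k !

    coeff₂-suc : ∀ k → coeff₂ (suc k) * (fromℕ (suc k) * 1ℚ) ≡ coeff₂ k
    coeff₂-suc k = trans (cong (coeff₂ (suc k) *_) (*-identityʳ (fromℕ (suc k)))) (1/!-suc k)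

    module Expm1Powers = SeriesPowers 0ℚ 1ℚ M expm1 θ-expm1

    whitney₂-zero : ∀ k → whitney₂ m r 0 k ≡ (1ℚ ◂ λ _ → 0ℚ) k
    whitney₂-zero = Expm1Powers.coeff-zero ρ (dilate ρ exp) θ-dilate-exp coeff₂ coeff₂-suc refl (*-zeroʳ (+ 1 / m)) refl

    whitney₂-rec : ∀ n k → whitney₂ m r (suc n) k ≡ node k * whitney₂ m r n k + (0ℚ ◂ whitney₂ m r n) k
    whitney₂-rec n k = begin
      W′                             ≡⟨ solve 3 (λ a n w → a := a :+ con 0 :* n :* w) refl W′ (fromℕ n) (whitney₂ m r n k) ⟩
      W′ + 0ℚ * fromℕ n * whitney₂ m r n k
        ≡⟨ Expm1Powers.coeff-rec ρ (dilate ρ exp) θ-dilate-exp coeff₂ coeff₂-suc n k ⟩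
      node k * whitney₂ m r n k + (0ℚ ◂ whitney₂ m r n) k ∎
      where W′ = whitney₂ m r (suc n) k

-- Transfer to R and the determinant formula

mainTheorem20 : ∀ {c ℓ} (R : CommutativeRing c ℓ) → let open CommutativeRing R in
    (φ : ℚ → Carrier) → RingMorphisms.IsRingHomomorphism +-*-rawRing rawRing φ →
    (m : ℕ) .{{_ : NonZero m}} (r n : ℕ) .{{_ : NonZero n}} (x : Carrier) →
    dowling R φ m r n x ≈ sign R n * det R (dowlingMatrix R φ m r n x)
mainTheorem20 R φ φ-hom m r n x = begin
  dowling R φ m r n x
    ≈⟨ R.sym (R.trans (R.*-congʳ (sign²≈1 n)) (R.*-identityˡ _)) ⟩
  (sign R n R.* sign R n) R.* dowling R φ m r n x
    ≈⟨ R.*-assoc _ _ _ ⟩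
  sign R n R.* (sign R n R.* dowling R φ m r n x)
    ≈⟨ R.*-congˡ (R.*-congˡ (sum-cong-≋ {suc n} (λ i → R.*-comm (W n (toℕ i)) (x RExp.^ toℕ i)))) ⟩
  sign R n R.* (sign R n R.* sum {suc n} (λ i → x RExp.^ toℕ i R.* W n (toℕ i)))
    ≈⟨ R.*-congˡ (det-bordered w W w-upper w-diag W-diag orthogonal n (x RExp.^_) (dowlingMatrix R φ m r n x) (λ _ → R.refl) (λ _ _ → R.refl)) ⟨
  sign R n R.* det R (dowlingMatrix R φ m r n x) ∎
  where
  module R = CommutativeRing R
  module RExp = Exp R.semiring
  open Sum R.semiring
  open Inversion R
  open RingMorphisms.IsRingHomomorphism φ-hom
  open FormalSeries.Whitney m r
  open import Algebra.Properties.Ring R.ring using (-1*x≈-x; -‿involutive)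
  open import Relation.Binary.Reasoning.Setoid R.setoid

  w W : ℕ → ℕ → R.Carrier
  w n k = φ (whitney₁ m r n k)
  W n k = φ (whitney₂ m r n k)

  node′ : ℕ → R.Carrier
  node′ j = φ (node j)

  φ-◂ : ∀ f k → φ ((0ℚ ◂ f) k) R.≈ (R.0# ◂ λ j → φ (f j)) k
  φ-◂ f zero    = 0#-homo
  φ-◂ f (suc k) = R.refl

  φ-δ : ∀ k → φ ((1ℚ ◂ λ _ → 0ℚ) k) R.≈ (R.1# ◂ λ _ → R.0#) k
  φ-δ zero    = 1#-homo
  φ-δ (suc k) = 0#-homo

  w₀ : ∀ k → w 0 k R.≈ (R.1# ◂ λ _ → R.0#) k
  w₀ k = R.trans (⟦⟧-cong (whitney₁-zero k)) (φ-δ k)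

  W₀ : ∀ k → W 0 k R.≈ (R.1# ◂ λ _ → R.0#) k
  W₀ k = R.trans (⟦⟧-cong (whitney₂-zero k)) (φ-δ k)

  w-rec : ∀ n k → w (suc n) k R.+ node′ n R.* w n k R.≈ (R.0# ◂ w n) k
  w-rec n k = R.trans (R.sym (R.trans (+-homo _ _) (R.+-congˡ (*-homo _ _))))
    (R.trans (⟦⟧-cong (whitney₁-rec n k)) (φ-◂ (whitney₁ m r n) k))

  W-rec : ∀ n k → W (suc n) k R.≈ node′ k R.* W n k R.+ (R.0# ◂ W n) k
  W-rec n k = R.trans (⟦⟧-cong (whitney₂-rec n k))
    (R.trans (+-homo _ _) (R.+-cong (*-homo _ _) (φ-◂ (whitney₂ m r n) k)))

  open Orthogonality node′ w W w₀ W₀ w-rec W-rec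

  sign²≈1 : ∀ n → sign R n R.* sign R n R.≈ R.1#
  sign²≈1 zero    = R.*-identityˡ _
  sign²≈1 (suc n) = R.trans (interchange _ _ _ _)
    (R.trans (R.*-cong (R.trans (-1*x≈-x _) (-‿involutive _)) (sign²≈1 n)) (R.*-identityˡ _))
    where open import Algebra.Properties.CommutativeSemigroup R.*-commutativeSemigroup using (interchange)
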